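{- Let $P$ be a join-semilattice with $\dim_\vee(P)=n<\infty$. The following are equivalent: (i) $P$ admits a one-to-one join-preserving map into a product of $n$ order-scattered chains; (ii) $P$ admits a one-to-one join-preserving map into a product of finitely many order-scattered chains; (iii) $\mathrm{Id}(P)$ is topologically scattered; (iv) $\mathrm{Id}(P)$ is order-scattered; (v) $\mathrm{mi}_\Delta(\mathrm{Id}(P))$ is order-scattered; (vi) the topological closure $\overline{\mathrm{mi}_\Delta(\mathrm{Id}(P))}$ is topologically scattered.
   Context: $\dim_\vee(P)$ is the least cardinal $\kappa$ such that $P$ admits a one-to-one join-preserving map into a product of $\kappa$ chains. $\mathrm{Id}(P)$ is the lattice of ideals (non-empty up-directed initial segments) of $P$ ordered by inclusion, viewed as a subspace of $\mathbf{2}^P\cong\mathcal{P}(P)$ with the product topology; closures are taken in this space. $\mathrm{mi}_\Delta(L)$ is the set of completely meet-irreducible elements of a complete lattice $L$ (elements $m$ having an upper cover $m^*$ with $z>m\Rightarrow z\geq m^*$). A poset is order-scattered if it contains no copy of $\mathbb{Q}$; a space is topologically scattered if every non-empty subset has an isolated point. -}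

module Defs where

open import Level using (Level; _⊔_; suc)
open import Algebra.Bundles.Raw using (RawMagma)
open import Algebra.Morphism.Structures using (module MagmaMorphisms)
import Algebra.Construct.NaturalChoice.Max as Max
open import Data.Bool.Base using (Bool; true; false; T)
open import Data.Empty using (⊥-elim)
open import Data.List.Base using (List)
open import Data.List.Relation.Unary.All using (All)
open import Data.Product.Base using (Σ; Σ-syntax; ∃-syntax; _×_; _,_; proj₁)
open import Data.Rational.Base as ℚ using (ℚ)
open import Data.Unit.Base using (tt)
open import Function.Bundles using (_↣_)
open import Relation.Binary.Bundles using (Poset; TotalOrder)
open import Relation.Binary.Lattice.Bundles using (JoinSemilattice)
open import Relation.Binary.Morphism.Structures using (IsOrderMonomorphism)
import Relation.Binary.Construct.On as On
import Relation.Binary.Properties.Poset as PosetProperties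
open import Relation.Binary.PropositionalEquality.Core
  using (_≡_; _≗_; refl; sym; trans; subst)
open import Relation.Nullary.Negation.Core using (¬_)
open import Relation.Unary using (Pred; _∈_; _⊆_; _≬_; Satisfiable)

private
  variable
    a b c i ℓ ℓ₁ ℓ₂ : Level

------------------------------------------------------------------------
-- Join-preserving embeddings into products of chains, and dim∨

-- The product of a family of chains, with its join operation.  It is only
-- a raw magma because nothing but the join and the equality is needed to
-- say that a map is one-to-one and join-preserving.
∏ : {I : Set i} → (I → TotalOrder a ℓ₁ ℓ₂) → RawMagma (i ⊔ a) (i ⊔ ℓ₁)
∏ {I = I} C = record
  { Carrier = (k : I) → TotalOrder.Carrier (C k)
  ; _≈_     = λ x y → ∀ k → TotalOrder._≈_ (C k) (x k) (y k)
  ; _∙_     = λ x y k → Max._⊔_ (C k) (x k) (y k)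
  }

joinMagma : JoinSemilattice c ℓ₁ ℓ₂ → RawMagma c ℓ₁
joinMagma P = record { Carrier = Carrier ; _≈_ = _≈_ ; _∙_ = _∨_ }
  where open JoinSemilattice P

JoinEmbedding : JoinSemilattice c ℓ₁ ℓ₂ → {I : Set i} →
                (I → TotalOrder c ℓ₁ ℓ₂) → Set (i ⊔ c ⊔ ℓ₁)
JoinEmbedding P C =
  Σ[ f ∈ (RawMagma.Carrier (joinMagma P) → RawMagma.Carrier (∏ C)) ]
    MagmaMorphisms.IsMagmaMonomorphism (joinMagma P) (∏ C) f

-- Cardinals are represented by types, compared by injections.  Nothing is
-- lost by taking the chains in the universe of P: only the image of P in
-- each chain matters, and it can be given the elements of P as carrier.
IsJoinDimension : JoinSemilattice c ℓ₁ ℓ₂ → Set i → Set (suc i ⊔ suc (c ⊔ ℓ₁ ⊔ ℓ₂))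
IsJoinDimension {c} {ℓ₁} {ℓ₂} {i} P κ =
  (Σ[ C ∈ (κ → TotalOrder c ℓ₁ ℓ₂) ] JoinEmbedding P C) ×
  (∀ (κ′ : Set i) (C : κ′ → TotalOrder c ℓ₁ ℓ₂) → JoinEmbedding P C → κ ↣ κ′)

------------------------------------------------------------------------
-- Order-theoretic notions

OrderScattered : Poset a ℓ₁ ℓ₂ → Set (a ⊔ ℓ₁ ⊔ ℓ₂)
OrderScattered L =
  ¬ (Σ[ f ∈ (ℚ → Carrier) ] IsOrderMonomorphism _≡_ _≈_ ℚ._≤_ _≤_ f)
  where open Poset L

module _ (L : Poset a ℓ₁ ℓ₂) where
  open Poset L
  open PosetProperties L using (_<_)

  IsUpperCover : Carrier → Carrier → Set (a ⊔ ℓ₁ ⊔ ℓ₂)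
  IsUpperCover m m* = m < m* × ¬ (∃[ z ] (m < z × z < m*))

  CompletelyMeetIrreducible : Pred Carrier (a ⊔ ℓ₁ ⊔ ℓ₂)
  CompletelyMeetIrreducible m =
    ∃[ m* ] (IsUpperCover m m* × (∀ z → m < z → m* ≤ z))

  miΔ : Poset (a ⊔ ℓ₁ ⊔ ℓ₂) ℓ₁ ℓ₂
  miΔ = On.poset {B = Σ Carrier CompletelyMeetIrreducible} L proj₁

------------------------------------------------------------------------
-- The power set 𝟐^ A and its product topology

-- Since 𝟐 is the type of Booleans, elements of 𝟐^ A are decidable subsets;
-- under excluded middle these are all the subsets of A.
𝟐^ : Set a → Set a
𝟐^ A = A → Bool

private
  T-antisym : ∀ x y → (T x → T y) → (T y → T x) → x ≡ y
  T-antisym false false _ _ = refl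
  T-antisym false true  _ g = ⊥-elim (g tt)
  T-antisym true  false f _ = ⊥-elim (f tt)
  T-antisym true  true  _ _ = refl

𝟐^-poset : Set a → Poset a a a
𝟐^-poset A = record
  { Carrier = 𝟐^ A
  ; _≈_     = _≗_
  ; _≤_     = λ s t → ∀ p → T (s p) → T (t p)
  ; isPartialOrder = record
    { isPreorder = record
      { isEquivalence = record
        { refl  = λ _ → refl
        ; sym   = λ e p → sym (e p)
        ; trans = λ e e′ p → trans (e p) (e′ p)
        }
      ; reflexive = λ e p → subst T (e p)
      ; trans     = λ f g p x → g p (f p x)
      }
    ; antisym = λ f g p → T-antisym _ _ (f p) (g p)
    }
  }

module _ {A : Set a} where

  -- The basic neighbourhoods of s are the sets of all t that agree with s
  -- on a given finite list of coordinates.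
  IsOpen : Pred (𝟐^ A) a → Set a
  IsOpen U = ∀ s → s ∈ U →
    Σ[ F ∈ List A ] (∀ t → All (λ p → t p ≡ s p) F → t ∈ U)

  -- The closure of S in the subspace X.
  ClosureIn : Pred (𝟐^ A) ℓ → Pred (𝟐^ A) b → Pred (𝟐^ A) (suc a ⊔ ℓ ⊔ b)
  ClosureIn X S s = s ∈ X × (∀ U → IsOpen U → s ∈ U → S ≬ U)

  IsIsolatedPointOf : Pred (𝟐^ A) ℓ → 𝟐^ A → Set (suc a ⊔ ℓ)
  IsIsolatedPointOf S s =
    s ∈ S × Σ[ U ∈ Pred (𝟐^ A) a ]
      (IsOpen U × s ∈ U × (∀ t → t ∈ S → t ∈ U → t ≗ s))

  -- Under excluded middle the universe level of the predicates S is
  -- immaterial.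
  TopologicallyScattered : Pred (𝟐^ A) ℓ → Set (suc a ⊔ ℓ)
  TopologicallyScattered X =
    ∀ (S : Pred (𝟐^ A) a) → S ⊆ X → Satisfiable S →
    ∃[ s ] IsIsolatedPointOf S s

------------------------------------------------------------------------
-- Ideals

module _ (P : JoinSemilattice c ℓ₁ ℓ₂) where
  open JoinSemilattice P

  record IsIdeal (s : 𝟐^ Carrier) : Set (c ⊔ ℓ₂) where
    field
      nonEmpty       : ∃[ x ] T (s x)
      upDirected     : ∀ x y → T (s x) → T (s y) →
                       ∃[ z ] (T (s z) × x ≤ z × y ≤ z)
      initialSegment : ∀ x y → y ≤ x → T (s x) → T (s y)

  Id : Poset (c ⊔ ℓ₂) c c
  Id = On.poset {B = Σ (𝟐^ Carrier) IsIdeal} (𝟐^-poset Carrier) proj₁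

  -- The elements of miΔ Id, as points of the space 𝟐^ Carrier.
  miΔIdeals : Pred (𝟐^ Carrier) (c ⊔ ℓ₂)
  miΔIdeals s = Σ[ h ∈ IsIdeal s ] CompletelyMeetIrreducible Id (s , h)

------------------------------------------------------------------------

EmbedsInScatteredChains : JoinSemilattice c ℓ₁ ℓ₂ → Set i → Set (i ⊔ suc (c ⊔ ℓ₁ ⊔ ℓ₂))
EmbedsInScatteredChains {c} {ℓ₁} {ℓ₂} P I =
  Σ[ C ∈ (I → TotalOrder c ℓ₁ ℓ₂) ]
    ((∀ k → OrderScattered (TotalOrder.poset (C k))) × JoinEmbedding P C)

{-# OPTIONS --safe #-}

-- Write f k for the coordinates of a join-embedding of P in n chains.  Every
-- ideal avoiding x lies in one of the n ideals { z | f k z < f k x }, so each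
-- completely meet-irreducible ideal has this form.  These ideals separate the
-- points of P and fall into n chains, and sending x to the members of the k-th
-- chain that avoid x embeds P in n chains, scattered as soon as mi_Δ(Id(P)) is.
-- A copy (I_q) of ℚ in Id(P) yields the set of all ⋃_{q<t} I_q, which has no
-- isolated point and lies in the closure of mi_Δ(Id(P)) if all I_q do.
--
-- For the converse, an ideal is an intersection of inverse images of n cuts,
-- one in each chain.  The intersections of cuts taken from prescribed windows
-- form scattered spaces: call x, y close when the window between them is
-- scattered; if a chain has a pair that is not close, then non-closeness is a
-- dense order on it, so that it contains ℚ.  This treats the chains one at a
-- time, leaving windows in which the cuts avoiding any given member of a cut
-- are already known to give a scattered space.
module Submission where

open import Level using (Level; Lift; lift; 0ℓ; _⊔_)
open import Defs
open import Axiom.ExcludedMiddle using (ExcludedMiddle)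
open import Axiom.Extensionality.Propositional using (Extensionality)
import Algebra.Construct.NaturalChoice.Max as Max
open import Algebra.Morphism.Structures using (module MagmaMorphisms)
open import Data.Bool.Base using (true; false; T)
open import Data.Empty using (⊥-elim)
open import Data.Fin.Base using (Fin; zero; suc)
import Data.Fin.Properties as Fin
open import Data.Integer.Base as ℤ using (_⊖_)
open import Data.List.Base using (List; []; _∷_; _++_; allFin)
import Data.List.Membership.Propositional as List
open import Data.List.Membership.Propositional.Properties using (∈-allFin)
open import Data.List.Relation.Unary.All as All using (All; []; _∷_)
open import Data.List.Relation.Unary.All.Properties using (++⁻ˡ; ++⁻ʳ)
open import Data.List.Relation.Unary.AllPairs using (AllPairs; []; _∷_)
open import Data.List.Relation.Unary.Any using (here; there)
open import Data.Nat.Base as ℕ using (ℕ; zero; suc)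
import Data.Nat.Properties as ℕ
open import Data.Product.Base using (Σ-syntax; ∃-syntax; _×_; _,_; proj₁; proj₂)
open import Data.Rational.Base as ℚ using (ℚ; mkℚ; _/_)
import Data.Rational.Properties as ℚ
open import Data.Sum.Base using (_⊎_; inj₁; inj₂; [_,_]′)
open import Data.Unit.Base using (⊤; tt)
open import Function.Base using (_∘_; id)
open import Function.Bundles using (_⇔_; mk⇔)
open import Relation.Binary.Bundles using (Poset; TotalOrder)
open import Relation.Binary.Core using (Rel)
open import Relation.Binary.Definitions
  using (Reflexive; Transitive; Dense; tri<; tri≈; tri>)
open import Relation.Binary.Lattice.Bundles using (JoinSemilattice)
open import Relation.Binary.Morphism.Structures using (IsOrderMonomorphism)
open import Relation.Binary.PropositionalEquality
  using (_≡_; _≗_; refl; sym; trans; subst)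
open import Relation.Nullary.Decidable.Core using (yes; no; does; decidable-stable)
open import Relation.Nullary.Negation.Core using (¬_)
open import Relation.Unary using (Pred; _∈_; _⊆_; _∪_; _∩_; Satisfiable)

private
  variable
    a b c ℓ ℓ′ ℓ₁ ℓ₂ : Level

-- Enumeration of the rationals.

unpair : ℕ → ℕ × ℕ
unpair zero    = 0 , 0
unpair (suc n) with unpair n
... | zero  , b = suc b , 0
... | suc a , b = a , suc b

-- `unpair` walks each antidiagonal from (s , 0) to (0 , s) and then jumps to (s + 1 , 0); the
-- induction on b follows one antidiagonal.
unpair-antidiagonal : ∀ b {a s} → s ≡ b ℕ.+ a →
                      ∃[ n ] unpair n ≡ (s , 0) → ∃[ n ] unpair n ≡ (a , b)
unpair-antidiagonal zero    refl e = e
unpair-antidiagonal (suc b) {a} refl e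
  with n , eq ← unpair-antidiagonal b {suc a} (sym (ℕ.+-suc b a)) e
  = suc n , step
  where
  step : unpair (suc n) ≡ (a , suc b)
  step rewrite eq = refl

unpair-corner : ∀ s → ∃[ n ] unpair n ≡ (s , 0)
unpair-corner zero    = 0 , refl
unpair-corner (suc s)
  with n , eq ← unpair-antidiagonal s {0} (sym (ℕ.+-identityʳ s)) (unpair-corner s)
  = suc n , step
  where
  step : unpair (suc n) ≡ (suc s , 0)
  step rewrite eq = refl

unpair-surjective : ∀ a b → ∃[ n ] unpair n ≡ (a , b)
unpair-surjective a b = unpair-antidiagonal b refl (unpair-corner (b ℕ.+ a))

-- Writing the numerator as a difference of naturals covers both signs.
nthRational : ℕ → ℚ
nthRational n with i , d ← unpair n with p , m ← unpair i = (p ⊖ m) / suc d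

nthRational-surjective : ∀ q → ∃[ n ] nthRational n ≡ q
nthRational-surjective q@(mkℚ z d _) = let n , eq = code z in n , trans eq (ℚ.↥p/↧p≡p q)
  where
  difference : ∀ p m → ∃[ n ] nthRational n ≡ (p ⊖ m) / suc d
  difference p m with i , eqᵢ ← unpair-surjective p m
                 with n , eqₙ ← unpair-surjective i d = n , value
    where
    value : nthRational n ≡ (p ⊖ m) / suc d
    value rewrite eqₙ | eqᵢ = refl
  code : ∀ z → ∃[ n ] nthRational n ≡ z / suc d
  code (ℤ.+ p)      = difference p 0
  code (ℤ.-[1+ m ]) = difference 0 (suc m)

-- Dense transitive relations contain a copy of ℚ.

module DenseOrder {A : Set a} {_≺_ : Rel A ℓ}
  (≺-trans : Transitive _≺_) (≺-dense : Dense _≺_) where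

  _⊏_ : Rel (ℚ × A) ℓ
  (q , x) ⊏ (r , y) = q ℚ.< r × x ≺ y

  Between : A → A → A → Set ℓ
  Between x z y = x ≺ y × y ≺ z

  -- The lower bound x moves along the list, so that density only has to supply a value between two
  -- neighbours. A key that is already present keeps its value.
  insert : ∀ q {l x z} → x ≺ z → AllPairs _⊏_ l → All (Between x z ∘ proj₂) l →
           ∃[ y ] ∃[ l′ ] (Between x z y × AllPairs _⊏_ l′ ×
             (q , y) List.∈ l′ × (∀ {e} → e List.∈ l → e List.∈ l′) ×
             (∀ {e} → e List.∈ l′ → e List.∈ l ⊎ e ≡ (q , y)))
  insert q {[]} x≺z [] [] =
    let y , between = ≺-dense x≺z in
    y , (q , y) ∷ [] , between , [] ∷ [] , here refl , (λ ()) , λ { (here e) → inj₂ e }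
  insert q {(r , w) ∷ l} {x} {z} x≺z (w⊏ ∷ sorted) ((x≺w , w≺z) ∷ bounded)
    with ℚ.<-cmp q r
  ... | tri< q<r _ _ =
    let y , x≺y , y≺w = ≺-dense x≺w in
    y , (q , y) ∷ (r , w) ∷ l , (x≺y , ≺-trans y≺w w≺z) ,
    ((q<r , y≺w) ∷ All.map (λ (r< , w≺) → ℚ.<-trans q<r r< , ≺-trans y≺w w≺) w⊏)
      ∷ w⊏ ∷ sorted ,
    here refl , there , λ { (here e) → inj₂ e ; (there e∈) → inj₁ e∈ }
  ... | tri≈ _ refl _ =
    w , (r , w) ∷ l , (x≺w , w≺z) , w⊏ ∷ sorted , here refl , id , inj₁
  ... | tri> _ _ r<q
    with y , l′ , (w≺y , y≺z) , sorted′ , y∈ , l⊆l′ , l′⊆ ←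
      insert q w≺z sorted
        (All.zipWith (λ ((_ , w≺) , (_ , ≺z)) → w≺ , ≺z) (w⊏ , bounded))
    = y , (r , w) ∷ l′ , (≺-trans x≺w w≺y , y≺z) ,
      All.tabulate (λ e∈ → [ All.lookup w⊏ , (λ { refl → r<q , w≺y }) ]′ (l′⊆ e∈)) ∷ sorted′ ,
      there y∈ , (λ { (here e) → here e ; (there e∈) → there (l⊆l′ e∈) }) ,
      λ { (here e) → inj₁ (here e)
        ; (there e∈) → [ inj₁ ∘ there , inj₂ ]′ (l′⊆ e∈) }

  sorted-mono : ∀ {l q r x y} → AllPairs _⊏_ l →
                (q , x) List.∈ l → (r , y) List.∈ l → q ℚ.< r → x ≺ y
  sorted-mono (e⊏ ∷ _) (here refl) (here refl) q<r = ⊥-elim (ℚ.<-irrefl refl q<r)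
  sorted-mono (e⊏ ∷ _) (here refl) (there r∈) q<r = proj₂ (All.lookup e⊏ r∈)
  sorted-mono (e⊏ ∷ _) (there q∈) (here refl) q<r =
    ⊥-elim (ℚ.<-asym q<r (proj₁ (All.lookup e⊏ q∈)))
  sorted-mono (_ ∷ sorted) (there q∈) (there r∈) q<r = sorted-mono sorted q∈ r∈ q<r

  module _ {x z : A} (x≺z : x ≺ z) where

    Stage : Set _
    Stage = Σ[ l ∈ List (ℚ × A) ] (AllPairs _⊏_ l × All (Between x z ∘ proj₂) l)

    extend : ∀ q (s : Stage) →
             Σ[ s′ ∈ Stage ] ∃[ y ] ((q , y) List.∈ proj₁ s′ × (∀ {e} → e List.∈ proj₁ s → e List.∈ proj₁ s′))
    extend q (l , sorted , bounded)
      with y , l′ , between , sorted′ , y∈ , l⊆l′ , l′⊆ ← insert q x≺z sorted bounded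
      = (l′ , sorted′ , All.tabulate
          λ e∈ → [ All.lookup bounded , (λ { refl → between }) ]′ (l′⊆ e∈)) ,
        y , y∈ , l⊆l′

    stage : ℕ → Stage
    stage zero    = [] , [] , []
    stage (suc n) = proj₁ (extend (nthRational n) (stage n))

    stage-mono : ∀ {m n e} → m ℕ.≤′ n → e List.∈ proj₁ (stage m) → e List.∈ proj₁ (stage n)
    stage-mono ℕ.≤′-refl        e∈ = e∈
    stage-mono {n = suc n} (ℕ.≤′-step m≤n) e∈ =
      proj₂ (proj₂ (proj₂ (extend (nthRational n) (stage n)))) (stage-mono m≤n e∈)

    image : ℚ → A
    image q = let n , _ = nthRational-surjective q in
      proj₁ (proj₂ (extend (nthRational n) (stage n)))

    image-∈ : ∀ q → ∃[ n ] ((q , image q) List.∈ proj₁ (stage n))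
    image-∈ q with n , eq ← nthRational-surjective q =
      suc n , subst (λ r → (r , _) List.∈ proj₁ (stage (suc n))) eq
                (proj₁ (proj₂ (proj₂ (extend (nthRational n) (stage n)))))

    -- Stages only grow, so both pairs lie in the stage `m ℕ.⊔ n`, whose list is sorted.
    image-mono : ∀ {q r} → q ℚ.< r → image q ≺ image r
    image-mono {q} {r} q<r =
      let m , q∈ = image-∈ q ; n , r∈ = image-∈ r in
      sorted-mono (proj₁ (proj₂ (stage (m ℕ.⊔ n))))
        (stage-mono (ℕ.≤⇒≤′ (ℕ.m≤m⊔n m n)) q∈) (stage-mono (ℕ.≤⇒≤′ (ℕ.m≤n⊔m m n)) r∈) q<r

    -- The relation `_≺_` may live on auxiliary data, such as pairs of rationals; only `g` has to
    -- turn it into strict inequality.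
    dense⇒¬scattered : (L : Poset c ℓ₁ ℓ₂) (g : A → Poset.Carrier L) →
                       (∀ {x y} → x ≺ y → Poset._≤_ L (g x) (g y) × ¬ Poset._≤_ L (g y) (g x)) →
                       ¬ OrderScattered L
    dense⇒¬scattered L g g-mono scattered = scattered (f , record
      { isOrderHomomorphism = record
        { cong = λ { refl → Eq.refl }
        ; mono = mono
        }
      ; injective = λ fq≈fr → ℚ.≤-antisym (cancel (reflexive fq≈fr))
                                          (cancel (reflexive (Eq.sym fq≈fr)))
      ; cancel = cancel
      })
      where
      open Poset L using (Carrier; _≤_; module Eq; reflexive) renaming (refl to ≤-refl)
      f : ℚ → Carrier
      f = g ∘ image
      mono : ∀ {q r} → q ℚ.≤ r → f q ≤ f r
      mono {q} {r} q≤r with ℚ.<-cmp q r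
      ... | tri< q<r _ _  = proj₁ (g-mono (image-mono q<r))
      ... | tri≈ _ refl _ = ≤-refl
      ... | tri> _ _ r<q  = ⊥-elim (ℚ.<-irrefl refl (ℚ.≤-<-trans q≤r r<q))
      cancel : ∀ {q r} → f q ≤ f r → q ℚ.≤ r
      cancel {q} {r} fq≤fr with ℚ.<-cmp q r
      ... | tri< q<r _ _  = ℚ.<⇒≤ q<r
      ... | tri≈ _ refl _ = ℚ.≤-refl
      ... | tri> _ _ r<q  = ⊥-elim (proj₂ (g-mono (image-mono r<q)) fq≤fr)

-- Basic neighbourhoods in the power set.

T-≡ : ∀ {x y} → (T x → T y) → (T y → T x) → x ≡ y
T-≡ f g = Poset.antisym (𝟐^-poset _) (λ _ → f) (λ _ → g) tt

module _ {A : Set a} where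

  Agree : List A → 𝟐^ A → 𝟐^ A → Set a
  Agree F t s = All (λ p → t p ≡ s p) F

  -- Isolation by a basic neighbourhood, in place of the arbitrary open set in `IsIsolatedPointOf`.
  Isolated : Pred (𝟐^ A) ℓ → Pred (𝟐^ A) _
  Isolated S s = s ∈ S × ∃[ F ] (∀ t → t ∈ S → Agree F t s → t ≗ s)

  Agree-open : ∀ F s → IsOpen (λ t → Agree F t s)
  Agree-open F s t t~s = F , λ u u~t → All.zipWith (λ (e , e′) → trans e e′) (u~t , t~s)

-- Consequences of excluded middle.

module Classical (em : ∀ ℓ → ExcludedMiddle ℓ) where

  by-contradiction : {X : Set ℓ} → ¬ ¬ X → X
  by-contradiction = decidable-stable (em _)

  ¬∀⇒∃¬ : {A : Set a} {Q : Pred A ℓ} → ¬ (∀ x → Q x) → ∃[ x ] ¬ Q x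
  ¬∀⇒∃¬ ¬∀ = by-contradiction λ ¬∃ → ¬∀ λ x → by-contradiction λ ¬q → ¬∃ (x , ¬q)

  ¬→⇒× : {X : Set a} {Y : Set b} → ¬ (X → Y) → X × ¬ Y
  ¬→⇒× ¬→ = by-contradiction (λ ¬x → ¬→ λ x → ⊥-elim (¬x (x , λ y → ¬→ λ _ → y)))

  -- If z lies above the x found so far, it replaces x: any listed y above z is above x, hence below
  -- x and so below z.
  above-maximal : ∀ {X : Set a} (R : Rel X ℓ) → Reflexive R → Transitive R →
                  ∀ xs x₀ → ∃[ x ] (R x₀ x × ∀ {y} → y List.∈ xs → R x y → R y x)
  above-maximal R R-refl R-trans []       x₀ = x₀ , R-refl , λ ()
  above-maximal R R-refl R-trans (z ∷ xs) x₀
    with x , x₀≤x , maximal ← above-maximal R R-refl R-trans xs x₀ | em _ {R x z}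
  ... | yes x≤z = z , R-trans x₀≤x x≤z , λ
          { (here refl) _   → R-refl
          ; (there y∈)  z≤y → R-trans (maximal y∈ (R-trans x≤z z≤y)) x≤z }
  ... | no x≰z = x , x₀≤x , λ
          { (here refl) x≤z → ⊥-elim (x≰z x≤z)
          ; (there y∈)  x≤y → maximal y∈ x≤y }

  module _ {A : Set a} where

    ⌊_⌋ : Pred A ℓ → 𝟐^ A
    ⌊ Q ⌋ p = does (em _ {Q p})

    ⌊⌋⁺ : (Q : Pred A ℓ) → ∀ {p} → Q p → T (⌊ Q ⌋ p)
    ⌊⌋⁺ Q {p} q with em _ {Q p}
    ... | yes _ = tt
    ... | no ¬q = ⊥-elim (¬q q)

    ⌊⌋⁻ : (Q : Pred A ℓ) → ∀ {p} → T (⌊ Q ⌋ p) → Q p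
    ⌊⌋⁻ Q {p} t with em _ {Q p}
    ... | yes q = q

  -- Permanence properties of scattered spaces.

  module _ {A : Set a} where

    -- Passing through the Boolean-valued `⌊ S ⌋` brings a predicate of any universe level down to
    -- the level fixed in `TopologicallyScattered`.
    isolated-point : {X : Pred (𝟐^ A) ℓ} → TopologicallyScattered X →
                     (S : Pred (𝟐^ A) ℓ′) → S ⊆ X → Satisfiable S → ∃[ s ] Isolated S s
    isolated-point scattered S S⊆X (s , s∈S)
      with s , s∈ , U , U-open , s∈U , unique ←
        scattered (Lift a ∘ T ∘ ⌊ S ⌋) (λ t∈ → S⊆X (⌊⌋⁻ S (Lift.lower t∈))) (s , lift (⌊⌋⁺ S s∈S))
      with F , F⊆U ← U-open s s∈U
      = s , ⌊⌋⁻ S (Lift.lower s∈) , F , λ t t∈S t~s → unique t (lift (⌊⌋⁺ S t∈S)) (F⊆U t t~s)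

    scattered : {X : Pred (𝟐^ A) ℓ} →
                (∀ (S : Pred (𝟐^ A) a) → S ⊆ X → Satisfiable S → ∃[ s ] Isolated S s) →
                TopologicallyScattered X
    scattered isolated S S⊆X S≠∅ with s , s∈S , F , unique ← isolated S S⊆X S≠∅ =
      s , s∈S , (λ t → Agree F t s) , Agree-open F s , All.universal (λ _ → refl) F , unique

    scattered-⊆ : {X : Pred (𝟐^ A) ℓ} {Y : Pred (𝟐^ A) ℓ′} → X ⊆ Y →
                  TopologicallyScattered Y → TopologicallyScattered X
    scattered-⊆ X⊆Y Y-sc S S⊆X = Y-sc S (λ s∈S → X⊆Y (S⊆X s∈S))

    scattered-≗ : {X : Pred (𝟐^ A) ℓ} → (∀ {s t} → s ∈ X → t ∈ X → s ≗ t) →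
                  TopologicallyScattered X
    scattered-≗ X-prop = scattered λ S S⊆X (s , s∈S) →
      s , s∈S , [] , λ t t∈S _ → X-prop (S⊆X t∈S) (S⊆X s∈S)

    -- A point of S ∩ X isolated by F is isolated in S, unless F leaves further
    -- points of S, which then all lie in Y.
    scattered-∪ : {X : Pred (𝟐^ A) ℓ} {Y : Pred (𝟐^ A) ℓ′} →
                  TopologicallyScattered X → TopologicallyScattered Y →
                  TopologicallyScattered (X ∪ Y)
    scattered-∪ {X = X} {Y} X-sc Y-sc = scattered isolated
      where
      isolated : ∀ (S : Pred (𝟐^ A) a) → S ⊆ X ∪ Y → Satisfiable S → ∃[ s ] Isolated S s
      isolated S S⊆ S≠∅ with em _ {Satisfiable (S ∩ X)}
      ... | no S∩X≡∅ = isolated-point Y-sc S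
              (λ s∈S → [ (λ s∈X → ⊥-elim (S∩X≡∅ (_ , s∈S , s∈X))) , id ]′ (S⊆ s∈S)) S≠∅
      ... | yes S∩X≠∅
        with s , (s∈S , _) , F , unique ← isolated-point X-sc (S ∩ X) proj₂ S∩X≠∅
        with em _ {Satisfiable (λ t → t ∈ S × Agree F t s × ¬ t ≗ s)}
      ... | no none = s , s∈S , F , λ t t∈S t~s →
              by-contradiction λ t≢s → none (t , t∈S , t~s , t≢s)
      ... | yes others
        with t , (t∈S , t~s , t≢s) , G , unique′ ← isolated-point Y-sc _
          (λ {u} (u∈S , u~s , u≢s) →
            [ (λ u∈X → ⊥-elim (u≢s (unique u (u∈S , u∈X) u~s))) , id ]′ (S⊆ u∈S))
          others
        with p , tp≢sp ← ¬∀⇒∃¬ t≢s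
        = t , t∈S , p ∷ F ++ G , λ { u u∈S (up≡tp ∷ u~t) → unique′ u
            ( u∈S
            , All.zipWith (λ (e , e′) → trans e e′) (++⁻ˡ F u~t , t~s)
            , λ u≗s → tp≢sp (trans (sym up≡tp) (u≗s p)))
            (++⁻ʳ F u~t) }

    scattered-⋃ : ∀ {m} {X : Fin m → Pred (𝟐^ A) ℓ} → (∀ k → TopologicallyScattered (X k)) →
                  TopologicallyScattered (λ s → ∃[ k ] s ∈ X k)
    scattered-⋃ {m = zero}  X-sc = scattered-≗ λ ()
    scattered-⋃ {m = suc m} X-sc =
      scattered-⊆ (λ { (zero , s∈) → inj₁ s∈ ; (suc k , s∈) → inj₂ (k , s∈) })
        (scattered-∪ (X-sc zero) (scattered-⋃ (X-sc ∘ suc)))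

    -- Fixing one coordinate cuts out an open piece of S; adding p to a list that isolates a point
    -- of the piece isolates it in S.
    isolated-in-clopen : {S : Pred (𝟐^ A) ℓ} (p : A) {s : 𝟐^ A} → s ∈ S →
                         TopologicallyScattered (λ t → t ∈ S × t p ≡ s p) →
                         ∃[ t ] Isolated S t
    isolated-in-clopen p {s} s∈S sc
      with t , (t∈S , tp≡sp) , F , unique ← isolated-point sc _ id (s , s∈S , refl)
      = t , t∈S , p ∷ F , λ { u u∈S (up≡tp ∷ u~t) → unique u (u∈S , trans up≡tp tp≡sp) u~t }

  -- Intersections of cuts taken from windows.

  module Boxes {A : Set a} {m : ℕ} (C : Fin m → TotalOrder c ℓ₁ ℓ₂)
    (f : ∀ k → A → TotalOrder.Carrier (C k))
    (C-scattered : ∀ k → OrderScattered (TotalOrder.poset (C k))) where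

    _≤[_]_ : A → Fin m → A → Set ℓ₂
    x ≤[ k ] y = TotalOrder._≤_ (C k) (f k x) (f k y)

    IsCut : Fin m → Pred (𝟐^ A) _
    IsCut k s = ∀ {x y} → y ≤[ k ] x → T (s x) → T (s y)

    Window : Set _
    Window = Fin m → Pred (𝟐^ A) a

    -- The sides need not be determined by t; `shrink` below exchanges one without changing the
    -- intersection.
    record Box (W : Window) (t : 𝟐^ A) : Set (a ⊔ ℓ₂) where
      constructor box
      field
        side       : Fin m → 𝟐^ A
        side-isCut : ∀ k → IsCut k (side k)
        side-∈     : ∀ k → side k ∈ W k
        ⊆side      : ∀ k {p} → T (t p) → T (side k p)
        ⋂side⊆     : ∀ {p} → (∀ k → T (side k p)) → T (t p)

    infixl 5 _↾[_]_
    _↾[_]_ : Window → Fin m → Pred (𝟐^ A) a → Window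
    (W ↾[ j ] Q) k s = s ∈ W k × (k ≡ j → s ∈ Q)

    Box-mono : ∀ {W W′} → (∀ k {s} → IsCut k s → s ∈ W k → s ∈ W′ k) → Box W ⊆ Box W′
    Box-mono W⊆ (box B cut B∈ t⊆ ⊆t) = box B cut (λ k → W⊆ k (cut k) (B∈ k)) t⊆ ⊆t

    ↾-mono : ∀ {W j Q Q′} → (∀ {s} → IsCut j s → s ∈ Q → s ∈ Q′) →
             Box (W ↾[ j ] Q) ⊆ Box (W ↾[ j ] Q′)
    ↾-mono Q⊆ = Box-mono λ { k cut (s∈W , s∈Q) → s∈W , λ { refl → Q⊆ cut (s∈Q refl) } }

    Contains Avoids : A → Pred (𝟐^ A) a
    Contains x s = Lift a (T (s x))
    Avoids   x s = Lift a (¬ T (s x))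

    -- In a `SupGood` window only the cuts near the union of the window can cause trouble: those
    -- missing some x of that union give a scattered space.
    Free SupGood : Fin m → Window → Set _
    Free    k W = ∀ {s} → s ∈ W k
    SupGood k W = ∀ x → (∃[ s ] (s ∈ W k × T (s x))) →
                  TopologicallyScattered (Box (W ↾[ k ] Avoids x))

    SupGood-↾ : ∀ {W j k Q} → SupGood k W → SupGood k (W ↾[ j ] Q)
    SupGood-↾ good x (s , (s∈W , _) , x∈s) =
      scattered-⊆ (Box-mono λ { _ _ ((s∈W , _) , avoids) → s∈W , avoids }) (good x (s , s∈W , x∈s))

    -- The points of Box W avoiding a point p that every side can contain have a
    -- side avoiding p; all other points of Box W are equal.
    corner-scattered : ∀ {W} → (∀ k → SupGood k W) → TopologicallyScattered (Box W)
    corner-scattered {W} good = scattered isolated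
      where
      isolated : ∀ S → S ⊆ Box W → Satisfiable S → ∃[ s ] Isolated S s
      isolated S S⊆ (s , s∈S)
        with em _ {∃[ t ] (t ∈ S × ∃[ p ] (¬ T (t p) × ∀ k → ∃[ u ] (u ∈ W k × T (u p))))}
      ... | yes (t , t∈S , p , p∉t , covered) =
        isolated-in-clopen p t∈S (scattered-⊆ avoiding (scattered-⋃ λ k → good k p (covered k)))
        where
        avoiding : (λ u → u ∈ S × u p ≡ t p) ⊆ (λ u → ∃[ k ] u ∈ Box (W ↾[ k ] Avoids p))
        avoiding (u∈S , up≡tp) with box B cut B∈ u⊆ ⊆u ← S⊆ u∈S
          with k , p∉Bk ← ¬∀⇒∃¬ (λ p∈B → p∉t (subst T up≡tp (⊆u p∈B)))
          = k , box B cut (λ l → B∈ l , λ { refl → lift p∉Bk }) u⊆ ⊆u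
      ... | no none = s , s∈S , [] , λ t t∈S _ p → T-≡ (⊆′ t∈S s∈S) (⊆′ s∈S t∈S)
        where
        ⊆′ : ∀ {t u} → t ∈ S → u ∈ S → ∀ {p} → T (t p) → T (u p)
        ⊆′ t∈S u∈S p∈t with box B _ B∈ t⊆ _ ← S⊆ t∈S = by-contradiction λ p∉u →
          none (_ , u∈S , _ , p∉u , λ k → B k , B∈ k , t⊆ k p∈t)

    -- Condensation along one chain.

    module Condensation (W : Window) (j : Fin m) (free : Free j W)
      -- The induction hypothesis on the remaining chains.
      (good⇒scattered : ∀ Q → SupGood j (W ↾[ j ] Q) → TopologicallyScattered (Box (W ↾[ j ] Q)))
      where

      -- The points with a member z ∉ L are handled by an open set.  In any other
      -- point the j-th side is contained in L or can be replaced by L.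
      split : ∀ L → IsCut j L → ∀ Q →
              (∀ z → T (L z)   → TopologicallyScattered (Box (W ↾[ j ] Q ∩ Avoids z))) →
              (∀ z → ¬ T (L z) → TopologicallyScattered (Box (W ↾[ j ] Q ∩ Contains z))) →
              TopologicallyScattered (Box (W ↾[ j ] Q))
      split L L-cut Q below above = scattered isolated
        where
        Q′ : Pred (𝟐^ A) a
        Q′ s = (∀ p → T (s p) → T (L p)) × (s ∈ Q ⊎ s ≗ L)

        -- A side in `Q′` that misses a member z of L is not L itself, so it satisfies Q and `below`
        -- applies.
        Q′-scattered : TopologicallyScattered (Box (W ↾[ j ] Q′))
        Q′-scattered = good⇒scattered Q′ λ { z (s , (_ , s∈Q′) , z∈s) →
          let z∈L = proj₁ (s∈Q′ refl) z z∈s in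
          scattered-⊆ (Box-mono λ { k _ ((u∈W , u∈Q′) , z∉u) → u∈W , λ { refl →
              [ id , (λ u≗L → ⊥-elim (Lift.lower (z∉u refl) (subst T (sym (u≗L z)) z∈L))) ]′
                (proj₂ (u∈Q′ refl))
              , z∉u refl } })
            (below z z∈L) }

        -- If `B j` is not contained in L, then L is contained in `B j`, as cuts of a chain are
        -- comparable. Since t lies in L, taking L as the j-th side leaves the intersection equal to
        -- t.
        shrink : ∀ {t} → (∀ p → T (t p) → T (L p)) → t ∈ Box (W ↾[ j ] Q) → t ∈ Box (W ↾[ j ] Q′)
        shrink {t} t⊆L (box B cut B∈ t⊆ ⊆t) with em _ {∀ p → T (B j p) → T (L p)}
        ... | yes Bj⊆L = box B cut
                (λ k → proj₁ (B∈ k) , λ { refl → Bj⊆L , inj₁ (proj₂ (B∈ k) refl) }) t⊆ ⊆t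
        ... | no Bj⊈L with p , p∉ ← ¬∀⇒∃¬ Bj⊈L with p∈Bj , p∉L ← ¬→⇒× p∉ =
          box B′ cut′ B′∈ t⊆′ λ p∈B′ → ⊆t (λ k → B′⊆B k (p∈B′ k))
          where
          L⊆Bj : ∀ {z} → T (L z) → T (B j z)
          L⊆Bj {z} z∈L with TotalOrder.total (C j) (f j z) (f j p)
          ... | inj₁ z≤p = cut j z≤p p∈Bj
          ... | inj₂ p≤z = ⊥-elim (p∉L (L-cut p≤z z∈L))

          B′ : Fin m → 𝟐^ A
          B′ k with k Fin.≟ j
          ... | yes _ = L
          ... | no _  = B k

          cut′ : ∀ k → IsCut k (B′ k)
          cut′ k with k Fin.≟ j
          ... | yes refl = L-cut
          ... | no _     = cut k

          B′∈ : ∀ k → B′ k ∈ (W ↾[ j ] Q′) k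
          B′∈ k with k Fin.≟ j
          -- Freeness of the window makes L an admissible side.
          ... | yes refl = free , λ _ → (λ _ → id) , inj₂ λ _ → refl
          ... | no k≢j   = proj₁ (B∈ k) , λ k≡j → ⊥-elim (k≢j k≡j)

          t⊆′ : ∀ k {q} → T (t q) → T (B′ k q)
          t⊆′ k q∈t with k Fin.≟ j
          ... | yes _ = t⊆L _ q∈t
          ... | no _  = t⊆ k q∈t

          B′⊆B : ∀ k {q} → T (B′ k q) → T (B k q)
          B′⊆B k q∈ with k Fin.≟ j
          ... | yes refl = L⊆Bj q∈
          ... | no _     = q∈

        isolated : ∀ S → S ⊆ Box (W ↾[ j ] Q) → Satisfiable S → ∃[ s ] Isolated S s
        isolated S S⊆ S≠∅ with em _ {∃[ t ] (t ∈ S × ∃[ z ] (T (t z) × ¬ T (L z)))}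
        ... | no none = isolated-point Q′-scattered S (λ t∈S → shrink
                (λ p p∈t → by-contradiction λ p∉L → none (_ , t∈S , p , p∈t , p∉L)) (S⊆ t∈S)) S≠∅
        ... | yes (t , t∈S , z , z∈t , z∉L) =
          isolated-in-clopen z t∈S (scattered-⊆ containing (above z z∉L))
          where
          containing : (λ u → u ∈ S × u z ≡ t z) ⊆ Box (W ↾[ j ] Q ∩ Contains z)
          containing (u∈S , uz≡tz) with box B cut B∈ u⊆ ⊆u ← S⊆ u∈S =
            box B cut (λ k → proj₁ (B∈ k) , λ { refl →
              proj₂ (B∈ k) refl , lift (u⊆ j (subst T (sym uz≡tz) z∈t)) }) u⊆ ⊆u

      Interval : A → A → Pred (𝟐^ A) a
      Interval x y = Contains x ∩ Avoids y

      -- Closeness of x and y: the cuts between them, used as j-th sides, give a scattered space.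
      Short : A → A → Set _
      Short x y = TopologicallyScattered (Box (W ↾[ j ] Interval x y))

      Short-≤ : ∀ {x y z} → z ≤[ j ] y → Short x y → Short x z
      Short-≤ z≤y = scattered-⊆ (↾-mono λ { cut (x∈s , lift z∉s) →
        x∈s , lift λ y∈s → z∉s (cut z≤y y∈s) })

      -- If y lies below x, no cut contains x and misses y, and the empty space is scattered.
      ¬Short⇒< : ∀ {x y} → ¬ Short x y → x ≤[ j ] y × ¬ y ≤[ j ] x
      ¬Short⇒< {x} {y} long with em _ {y ≤[ j ] x}
      ... | yes y≤x = ⊥-elim (long (scattered-≗ λ { (box B cut B∈ _ _) _ →
                        let lift x∈ , lift y∉ = proj₂ (B∈ j) refl in ⊥-elim (y∉ (cut j y≤x x∈)) }))
      ... | no y≰x  = [ id , (λ y≤x → ⊥-elim (y≰x y≤x)) ]′ (TotalOrder.total (C j) _ _) , y≰x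

      -- Split at the cut of all z close to x. If every z outside it were close to y, both sides of
      -- the split would be scattered, making x and y close.
      ¬Short-dense : ∀ {x y} → ¬ Short x y → ∃[ z ] (¬ Short x z × ¬ Short z y)
      ¬Short-dense {x} {y} long = by-contradiction λ none → long (split ⌊ Short x ⌋
        (λ z≤w x~w → ⌊⌋⁺ (Short x) (Short-≤ z≤w (⌊⌋⁻ (Short x) x~w)))
        (Interval x y)
        (λ z x~z → scattered-⊆ (↾-mono λ { _ ((x∈s , _) , z∉s) → x∈s , z∉s }) (⌊⌋⁻ (Short x) x~z))
        (λ z x≁z → scattered-⊆ (↾-mono λ { _ ((_ , y∉s) , z∈s) → z∈s , y∉s })
          (by-contradiction λ z≁y → none (z , (λ x~z → x≁z (⌊⌋⁺ (Short x) x~z)) , z≁y))))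

      all-Short : ∀ x y → Short x y
      all-Short x y = by-contradiction λ long →
        DenseOrder.dense⇒¬scattered {_≺_ = λ u v → ¬ Short u v}
          (λ u≺v v≺w u~w → u≺v (Short-≤ (proj₁ (¬Short⇒< v≺w)) u~w))
          ¬Short-dense long (TotalOrder.poset (C j)) (f j) ¬Short⇒< (C-scattered j)

      -- Splitting at the empty cut supplies a member x of the side, splitting at the full cut a
      -- non-member y; what remains is an interval.
      free-scattered : TopologicallyScattered (Box W)
      free-scattered = scattered-⊆ (Box-mono λ _ _ s∈W → s∈W , λ _ → lift tt)
        (split (λ _ → false) (λ _ ()) (λ _ → Lift a ⊤) (λ _ ()) λ x _ →
          scattered-⊆ (↾-mono λ _ → proj₂)
            (split (λ _ → true) (λ _ _ → tt) (Contains x) (λ y _ → all-Short x y)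
              λ _ y∉ → ⊥-elim (y∉ tt)))

    -- Induction on `js`, which lists every chain whose window is not yet known to be `SupGood`.
    -- Condensation trades a free window for its `SupGood` restrictions and keeps the status of the
    -- others.
    free-or-good⇒scattered : ∀ js W → (∀ k → (k List.∈ js × Free k W) ⊎ SupGood k W) →
                             TopologicallyScattered (Box W)
    free-or-good⇒scattered [] W h = corner-scattered λ k → [ (λ ()) , id ]′ (h k)
    free-or-good⇒scattered (j ∷ js) W h with h j
    ... | inj₂ good = free-or-good⇒scattered js W h′
      where
      h′ : ∀ k → (k List.∈ js × Free k W) ⊎ SupGood k W
      h′ k with h k
      ... | inj₁ (here refl , _)    = inj₂ good
      ... | inj₁ (there k∈ , free) = inj₁ (k∈ , free)
      ... | inj₂ good′             = inj₂ good′
    ... | inj₁ (_ , free) = Condensation.free-scattered W j free λ Q good →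
      free-or-good⇒scattered js (W ↾[ j ] Q) (h′ Q good)
      where
      h′ : ∀ Q → SupGood j (W ↾[ j ] Q) →
           ∀ k → (k List.∈ js × Free k (W ↾[ j ] Q)) ⊎ SupGood k (W ↾[ j ] Q)
      h′ Q good k with k Fin.≟ j
      ... | yes refl = inj₂ good
      ... | no k≢j with h k
      ...   | inj₁ (here refl , _)     = ⊥-elim (k≢j refl)
      ...   | inj₁ (there k∈ , free′) = inj₁ (k∈ , (free′ , λ k≡j → ⊥-elim (k≢j k≡j)))
      ...   | inj₂ good′              = inj₂ (SupGood-↾ {Q = Q} good′)

    box-scattered : TopologicallyScattered (Box λ _ _ → Lift a ⊤)
    box-scattered = free-or-good⇒scattered (allFin m) _ λ k → inj₁ (∈-allFin k , lift tt)

-- Ideals, and copies of ℚ among them.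

ℚ-unbounded-below : ∀ q → ∃[ r ] r ℚ.< q
ℚ-unbounded-below q = q ℚ.- ℚ.1ℚ ,
  subst (q ℚ.- ℚ.1ℚ ℚ.<_) (ℚ.+-identityʳ q) (ℚ.+-monoʳ-< q (ℚ.negative⁻¹ (ℚ.- ℚ.1ℚ)))

module Ideals (em : ∀ ℓ → ExcludedMiddle ℓ) (P : JoinSemilattice c ℓ₁ ℓ₂) where
  open Classical em
  open JoinSemilattice P using (Carrier; _≤_; _∨_; x≤x∨y; y≤x∨y; ∨-least)
  module P = JoinSemilattice P

  ∨-∈ : ∀ {s} → IsIdeal P s → ∀ {x y} → T (s x) → T (s y) → T (s (x ∨ y))
  ∨-∈ s-ideal x∈s y∈s =
    let z , z∈s , x≤z , y≤z = upDirected _ _ x∈s y∈s in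
    initialSegment _ _ (∨-least x≤z y≤z) z∈s
    where open IsIdeal s-ideal

  ideal-bound : ∀ {s m} → IsIdeal P s → (x : Fin m → Carrier) → (∀ k → T (s (x k))) →
                ∃[ y ] (T (s y) × ∀ k → x k ≤ y)
  ideal-bound {m = zero}  s-ideal x x∈s =
    let y , y∈s = IsIdeal.nonEmpty s-ideal in y , y∈s , λ ()
  ideal-bound {m = suc m} s-ideal x x∈s =
    let y , y∈s , x≤y = ideal-bound s-ideal (x ∘ suc) (x∈s ∘ suc) in
    x zero ∨ y , ∨-∈ s-ideal (x∈s zero) y∈s ,
    λ { zero → x≤x∨y _ _ ; (suc k) → P.trans (x≤y k) (y≤x∨y _ _) }

  -- Each union of the ideals below t is a limit both of those ideals and of
  -- the unions below smaller rationals.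
  module LeftLimits (f : ℚ → Poset.Carrier (Id P))
    (f-mono : IsOrderMonomorphism _≡_ (Poset._≈_ (Id P)) ℚ._≤_ (Poset._≤_ (Id P)) f) where
    open IsOrderMonomorphism f-mono using (mono; cancel)

    I : ℚ → 𝟐^ Carrier
    I q = proj₁ (f q)

    ∈I<_ : ℚ → Pred Carrier 0ℓ
    (∈I< t) p = ∃[ q ] (q ℚ.< t × T (I q p))

    I<_ : ℚ → 𝟐^ Carrier
    I< t = ⌊ ∈I< t ⌋

    I⊆I< : ∀ {q t} → q ℚ.< t → ∀ p → T (I q p) → T ((I< t) p)
    I⊆I< {t = t} q<t p p∈ = ⌊⌋⁺ (∈I< t) (_ , q<t , p∈)

    I<⊆I : ∀ {t} p → T ((I< t) p) → T (I t p)
    I<⊆I {t} p p∈ = let q , q<t , p∈I = ⌊⌋⁻ (∈I< t) p∈ in mono (ℚ.<⇒≤ q<t) p p∈I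

    I<-isIdeal : ∀ t → IsIdeal P (I< t)
    I<-isIdeal t = record
      { nonEmpty = let q , q<t = ℚ-unbounded-below t ; x , x∈ = IsIdeal.nonEmpty (proj₂ (f q))
                   in x , I⊆I< q<t x x∈
      ; upDirected = λ x y x∈ y∈ → directed x y (⌊⌋⁻ (∈I< t) x∈) (⌊⌋⁻ (∈I< t) y∈)
      ; initialSegment = λ x y y≤x x∈ →
          let q , q<t , x∈I = ⌊⌋⁻ (∈I< t) x∈ in
          I⊆I< q<t y (IsIdeal.initialSegment (proj₂ (f q)) x y y≤x x∈I)
      }
      where
      directed : ∀ x y → (∈I< t) x → (∈I< t) y → ∃[ z ] (T ((I< t) z) × x ≤ z × y ≤ z)
      directed x y (q , q<t , x∈) (r , r<t , y∈) with ℚ.≤-total q r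
      ... | inj₁ q≤r = let z , z∈ , bounds = IsIdeal.upDirected (proj₂ (f r)) x y (mono q≤r x x∈) y∈
                       in z , I⊆I< r<t z z∈ , bounds
      ... | inj₂ r≤q = let z , z∈ , bounds = IsIdeal.upDirected (proj₂ (f q)) x y x∈ (mono r≤q y y∈)
                       in z , I⊆I< q<t z z∈ , bounds

    -- Each coordinate in F that belongs to the union is already in some `I r` with r < t; the
    -- largest of these finitely many r serves for all of F.
    approximate : ∀ F t → ∃[ q ] (q ℚ.< t × (∀ s → (∀ p → T (I q p) → T (s p)) →
                    (∀ p → T (s p) → T ((I< t) p)) → Agree F s (I< t)))
    approximate [] t = let q , q<t = ℚ-unbounded-below t in q , q<t , λ _ _ _ → []
    approximate (p ∷ F) t with q , q<t , agree ← approximate F t | em _ {(∈I< t) p}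
    ... | no p∉ = q , q<t , λ s I⊆s s⊆I< →
            T-≡ (s⊆I< p) (λ p∈ → ⊥-elim (p∉ (⌊⌋⁻ (∈I< t) p∈))) ∷ agree s I⊆s s⊆I<
    ... | yes (r , r<t , p∈I) with ℚ.≤-total q r
    ...   | inj₁ q≤r = r , r<t , λ s I⊆s s⊆I< →
              T-≡ (s⊆I< p) (λ _ → I⊆s p p∈I) ∷
              agree s (λ x x∈ → I⊆s x (mono q≤r x x∈)) s⊆I<
    ...   | inj₂ r≤q = q , q<t , λ s I⊆s s⊆I< →
              T-≡ (s⊆I< p) (λ _ → I⊆s p (mono r≤q p p∈I)) ∷ agree s I⊆s s⊆I<

    -- A finite list isolating `I< t` would identify it with `I< r` for some r < t. For r < u < t
    -- this gives I u ⊆ I< t = I< r ⊆ I r, against the order embedding.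
    ¬scattered : {X : Pred (𝟐^ Carrier) ℓ} → (∀ t → I< t ∈ X) → ¬ TopologicallyScattered X
    ¬scattered I<∈X X-sc
      with s , (t , refl) , F , unique ←
        isolated-point X-sc (λ s → ∃[ t ] s ≡ I< t) (λ { (t , refl) → I<∈X t }) (_ , ℚ.0ℚ , refl)
      with q , q<t , agree ← approximate F t
      with r , q<r , r<t ← ℚ.<-dense q<t
      with u , r<u , u<t ← ℚ.<-dense r<t
      = ℚ.<-irrefl refl (ℚ.≤-<-trans u≤r r<u)
      where
      I<r≗I<t : I< r ≗ I< t
      I<r≗I<t = unique (I< r) (r , refl)
        (agree (I< r) (λ p → I⊆I< q<r p) λ p p∈ → I⊆I< r<t p (I<⊆I p p∈))

      u≤r : u ℚ.≤ r
      u≤r = cancel λ p p∈ → I<⊆I p (subst T (sym (I<r≗I<t p)) (I⊆I< u<t p p∈))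

  Id-scattered : TopologicallyScattered (IsIdeal P) → OrderScattered (Id P)
  Id-scattered sc (f , f-mono) = LeftLimits.¬scattered f f-mono (LeftLimits.I<-isIdeal f f-mono) sc

  miΔ⊆Id : ∀ {f : ℚ → Poset.Carrier (miΔ (Id P))} →
           IsOrderMonomorphism _≡_ (Poset._≈_ (miΔ (Id P))) ℚ._≤_ (Poset._≤_ (miΔ (Id P))) f →
           IsOrderMonomorphism _≡_ (Poset._≈_ (Id P)) ℚ._≤_ (Poset._≤_ (Id P)) (proj₁ ∘ f)
  miΔ⊆Id f-mono = record
    { isOrderHomomorphism = record { cong = cong ; mono = mono }
    ; injective = injective
    ; cancel = cancel
    }
    where open IsOrderMonomorphism f-mono

  miΔ-scattered : OrderScattered (Id P) → OrderScattered (miΔ (Id P))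
  miΔ-scattered sc (f , f-mono) = sc (proj₁ ∘ f , miΔ⊆Id f-mono)

  miΔ-scattered-of-closure : TopologicallyScattered (ClosureIn (IsIdeal P) (miΔIdeals P)) →
                             OrderScattered (miΔ (Id P))
  miΔ-scattered-of-closure sc (f , f-mono) = ¬scattered I<∈closure sc
    where
    open LeftLimits (proj₁ ∘ f) (miΔ⊆Id f-mono)
    I<∈closure : ∀ t → I< t ∈ ClosureIn (IsIdeal P) (miΔIdeals P)
    I<∈closure t = I<-isIdeal t , λ U U-open I<∈U →
      let F , F⊆U = U-open (I< t) I<∈U
          q , q<t , agree = approximate F t
      in I q , (proj₂ (proj₁ (f q)) , proj₂ (f q)) ,
         F⊆U (I q) (agree (I q) (λ _ → id) (I⊆I< q<t))

  -- Ideals as intersections of cuts.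

  module Embedding {m} (C : Fin m → TotalOrder c ℓ₁ ℓ₂) (emb : JoinEmbedding P C) where
    open MagmaMorphisms.IsMagmaMonomorphism (proj₂ emb) using (homo; ⟦⟧-cong; injective)
    private module C k = TotalOrder (C k)

    f : ∀ k → Carrier → C.Carrier k
    f k x = proj₁ emb x k

    _≤[_]_ : Carrier → Fin m → Carrier → Set ℓ₂
    x ≤[ k ] y = C._≤_ k (f k x) (f k y)

    ≤⇒≤[] : ∀ k {x y} → x ≤ y → x ≤[ k ] y
    ≤⇒≤[] k {x} {y} x≤y = C.trans k (Max.x≤x⊔y (C k) (f k x) (f k y)) (C.reflexive k
      (C.Eq.trans k (C.Eq.sym k (homo x y k))
        (⟦⟧-cong (P.antisym (∨-least x≤y P.refl) (y≤x∨y x y)) k)))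

    ∨-least-≤[] : ∀ k {x y z} → x ≤[ k ] z → y ≤[ k ] z → (x ∨ y) ≤[ k ] z
    ∨-least-≤[] k {x} {y} x≤z y≤z =
      C.trans k (C.reflexive k (homo x y k)) (Max.⊔-lub (C k) x≤z y≤z)

    -- Under the hypothesis x ∨ y and y have the same image, so they are equal by injectivity.
    ≤[]⇒≤ : ∀ {x y} → (∀ k → x ≤[ k ] y) → x ≤ y
    ≤[]⇒≤ {x} {y} x≤y = P.trans (x≤x∨y x y) (P.reflexive (injective λ k →
      C.antisym k (∨-least-≤[] k (x≤y k) (C.refl k)) (≤⇒≤[] k (y≤x∨y x y))))

    ideals-scattered : (∀ k → OrderScattered (TotalOrder.poset (C k))) →
                       TopologicallyScattered (IsIdeal P)
    ideals-scattered C-sc = scattered-⊆ ideal-box box-scattered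
      where
      open Boxes C f C-sc hiding (_≤[_]_)
      -- The sides are the cuts generated by s. If x lies in all of them, the finitely many
      -- witnesses have a common bound in s, which dominates x in every coordinate.
      ideal-box : IsIdeal P ⊆ Box (λ _ _ → Lift c ⊤)
      ideal-box {s} s-ideal = box (λ k → ⌊ Below k ⌋)
        (λ k z≤x x∈ → let y , y∈s , x≤y = ⌊⌋⁻ (Below k) x∈ in
                      ⌊⌋⁺ (Below k) (y , y∈s , C.trans k z≤x x≤y))
        (λ _ → lift tt)
        (λ k x∈s → ⌊⌋⁺ (Below k) (_ , x∈s , C.refl k))
        λ {x} x∈ →
          let y , y∈s , bound = ideal-bound s-ideal
                (λ k → proj₁ (⌊⌋⁻ (Below k) (x∈ k))) (λ k → proj₁ (proj₂ (⌊⌋⁻ (Below k) (x∈ k))))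
          in IsIdeal.initialSegment s-ideal y x (≤[]⇒≤ λ k →
               C.trans k (proj₂ (proj₂ (⌊⌋⁻ (Below k) (x∈ k)))) (≤⇒≤[] k (bound k))) y∈s
        where
        Below : Fin m → Pred Carrier _
        Below k x = ∃[ y ] (T (s y) × x ≤[ k ] y)

    -- Completely meet-irreducible ideals.

    Lower : Fin m → Carrier → Pred Carrier ℓ₂
    Lower k x z = ¬ x ≤[ k ] z

    lower : Fin m → Carrier → 𝟐^ Carrier
    lower k x = ⌊ Lower k x ⌋

    ∉lower : ∀ k x → ¬ T (lower k x x)
    ∉lower k x x∈ = ⌊⌋⁻ (Lower k x) x∈ (C.refl k)

    lower-isIdeal : ∀ k x → ∃[ z ] T (lower k x z) → IsIdeal P (lower k x)
    lower-isIdeal k x inhabited = record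
      { nonEmpty = inhabited
      ; upDirected = λ y z y∈ z∈ → y ∨ z ,
          ⌊⌋⁺ (Lower k x) (directed (⌊⌋⁻ (Lower k x) y∈) (⌊⌋⁻ (Lower k x) z∈)) ,
          x≤x∨y y z , y≤x∨y y z
      ; initialSegment = λ y z z≤y y∈ → ⌊⌋⁺ (Lower k x) λ x≤z →
          ⌊⌋⁻ (Lower k x) y∈ (C.trans k x≤z (≤⇒≤[] k z≤y))
      }
      where
      directed : ∀ {y z} → Lower k x y → Lower k x z → Lower k x (y ∨ z)
      directed {y} {z} x≰y x≰z x≤y∨z with C.total k (f k y) (f k z)
      ... | inj₁ y≤z = x≰z (C.trans k x≤y∨z (∨-least-≤[] k y≤z (C.refl k)))
      ... | inj₂ z≤y = x≰y (C.trans k x≤y∨z (∨-least-≤[] k (C.refl k) z≤y))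

    lower-total : ∀ k x y → (∀ p → T (lower k x p) → T (lower k y p)) ⊎
                            (∀ p → T (lower k y p) → T (lower k x p))
    lower-total k x y with C.total k (f k x) (f k y)
    ... | inj₁ x≤y = inj₁ λ p p∈ → ⌊⌋⁺ (Lower k y) λ y≤p → ⌊⌋⁻ (Lower k x) p∈ (C.trans k x≤y y≤p)
    ... | inj₂ y≤x = inj₂ λ p p∈ → ⌊⌋⁺ (Lower k x) λ x≤p → ⌊⌋⁻ (Lower k y) p∈ (C.trans k y≤x x≤p)

    -- Otherwise each coordinate of x is dominated by a member of s, and a common bound of these
    -- members in s lies above x.
    ideal⊆lower : ∀ {s x} → IsIdeal P s → ¬ T (s x) → ∃[ k ] (∀ p → T (s p) → T (lower k x p))
    ideal⊆lower {s} {x} s-ideal x∉s = by-contradiction λ none →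
      let above : ∀ k → ∃[ p ] (T (s p) × x ≤[ k ] p)
          above k = by-contradiction λ ¬above → none (k , λ p p∈s →
            ⌊⌋⁺ (Lower k x) λ x≤p → ¬above (p , p∈s , x≤p))
          y , y∈s , bound = ideal-bound s-ideal (proj₁ ∘ above) (proj₁ ∘ proj₂ ∘ above)
      in x∉s (IsIdeal.initialSegment s-ideal y x
           (≤[]⇒≤ λ k → C.trans k (proj₂ (proj₂ (above k))) (≤⇒≤[] k (bound k))) y∈s)

    -- Take x in the upper cover of s but not in s, and k with s ⊆ `lower k x`. If this inclusion
    -- were strict, `lower k x` would contain the upper cover and hence x.
    miΔ⇒lower : ∀ {s} → s ∈ miΔIdeals P → ∃[ k ] ∃[ x ] s ≗ lower k x
    miΔ⇒lower {s} (s-ideal , (s* , _) , ((s⊆s* , s≉s*) , _) , least)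
      with x , x∈s*∖s ← ¬∀⇒∃¬ (λ s*⊆s → s≉s* (Poset.antisym (𝟐^-poset Carrier) s⊆s* s*⊆s))
      with x∈s* , x∉s ← ¬→⇒× x∈s*∖s
      with k , s⊆ ← ideal⊆lower s-ideal x∉s
      = k , x , by-contradiction λ s≉ → ∉lower k x
          (least (lower k x , lower-isIdeal k x (let z , z∈s = IsIdeal.nonEmpty s-ideal in z , s⊆ z z∈s))
            (s⊆ , s≉) x x∈s*)

    -- The upper cover is the ideal generated by s and x: by maximality every ideal strictly above s
    -- contains x.
    maximal-avoiding⇒miΔ : ∀ {s x} → IsIdeal P s → ¬ T (s x) →
      (∀ t → IsIdeal P t → ¬ T (t x) → (∀ p → T (s p) → T (t p)) → t ≗ s) → s ∈ miΔIdeals P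
    maximal-avoiding⇒miΔ {s} {x} s-ideal x∉s maximal =
      s-ideal , (s* , s*-isIdeal) , ((s⊆s* , s≉s*) , no-between) , least
      where
      open IsIdeal s-ideal
      Join : Pred Carrier _
      Join z = ∃[ y ] (T (s y) × z ≤ y ∨ x)

      s* : 𝟐^ Carrier
      s* = ⌊ Join ⌋

      s*-isIdeal : IsIdeal P s*
      s*-isIdeal = record
        { nonEmpty = let y , y∈s = nonEmpty in y , ⌊⌋⁺ Join (y , y∈s , x≤x∨y y x)
        ; upDirected = λ u v u∈ v∈ →
            let y , y∈s , u≤ = ⌊⌋⁻ Join u∈
                z , z∈s , v≤ = ⌊⌋⁻ Join v∈
                w , w∈s , y≤w , z≤w = upDirected y z y∈s z∈s
            in w ∨ x , ⌊⌋⁺ Join (w , w∈s , P.refl) , P.trans u≤ (∨-monoˡ y≤w) , P.trans v≤ (∨-monoˡ z≤w)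
        ; initialSegment = λ u v v≤u u∈ →
            let y , y∈s , u≤ = ⌊⌋⁻ Join u∈ in ⌊⌋⁺ Join (y , y∈s , P.trans v≤u u≤)
        }
        where
        ∨-monoˡ : ∀ {y w} → y ≤ w → y ∨ x ≤ w ∨ x
        ∨-monoˡ {_} {w} y≤w = ∨-least (P.trans y≤w (x≤x∨y w x)) (y≤x∨y w x)

      s⊆s* : ∀ p → T (s p) → T (s* p)
      s⊆s* p p∈s = ⌊⌋⁺ Join (p , p∈s , x≤x∨y p x)

      s≉s* : ¬ s ≗ s*
      s≉s* s≗s* = x∉s (subst T (sym (s≗s* x))
        (let y , y∈s = nonEmpty in ⌊⌋⁺ Join (y , y∈s , y≤x∨y y x)))

      least : ∀ t → Poset._≤_ (Id P) (s , s-ideal) t × ¬ s ≗ proj₁ t → ∀ p → T (s* p) → T (proj₁ t p)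
      least (t , t-ideal) (s⊆t , s≉t) p p∈s* =
        let y , y∈s , p≤ = ⌊⌋⁻ Join p∈s*
            x∈t = by-contradiction λ x∉t → s≉t λ q → sym (maximal t t-ideal x∉t s⊆t q)
        in IsIdeal.initialSegment t-ideal _ p p≤ (∨-∈ t-ideal (s⊆t y y∈s) x∈t)

      no-between : ¬ (∃[ t ] ((Poset._≤_ (Id P) (s , s-ideal) t × ¬ s ≗ proj₁ t) ×
                              (Poset._≤_ (Id P) t (s* , s*-isIdeal) × ¬ proj₁ t ≗ s*)))
      no-between (t , s<t , t⊆s* , t≉s*) =
        t≉s* (Poset.antisym (𝟐^-poset Carrier) t⊆s* (least t s<t))

    -- Every ideal avoiding x lies in one of the finitely many lower k x, so a
    -- maximal one exists without Zorn's lemma.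
    miΔ-separates : ∀ {x y} → ¬ x ≤ y → ∃[ s ] (s ∈ miΔIdeals P × T (s y) × ¬ T (s x))
    miΔ-separates {x} {y} x≰y
      with k₀ , x≰y[k₀] ← ¬∀⇒∃¬ (λ x≤y → x≰y (≤[]⇒≤ x≤y))
      with k , k₀⊆k , maximal ← above-maximal (λ k l → ∀ p → T (lower k x p) → T (lower l x p))
             (λ _ → id) (λ k⊆l l⊆n p → l⊆n p ∘ k⊆l p) (allFin m) k₀
      with y∈ ← k₀⊆k y (⌊⌋⁺ (Lower k₀ x) x≰y[k₀])
      = lower k x ,
        maximal-avoiding⇒miΔ (lower-isIdeal k x (y , y∈)) (∉lower k x)
          (λ t t-ideal x∉t k⊆t →
            let l , t⊆l = ideal⊆lower t-ideal x∉t
                l⊆k = maximal (∈-allFin l) (λ p → t⊆l p ∘ k⊆t p)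
            in Poset.antisym (𝟐^-poset Carrier) (λ p → l⊆k p ∘ t⊆l p) k⊆t) ,
        y∈ , ∉lower k x

    -- The embedding given by chains of completely meet-irreducible ideals.

    miΔ[_] : Fin m → Pred (𝟐^ Carrier) _
    miΔ[ k ] s = s ∈ miΔIdeals P × ∃[ x ] s ≗ lower k x

    miΔ[]-total : ∀ k {s t} → s ∈ miΔ[ k ] → t ∈ miΔ[ k ] →
                  (∀ p → T (s p) → T (t p)) ⊎ (∀ p → T (t p) → T (s p))
    miΔ[]-total k (_ , x , s≗) (_ , y , t≗) with lower-total k x y
    ... | inj₁ x⊆y = inj₁ λ p → subst T (sym (t≗ p)) ∘ x⊆y p ∘ subst T (s≗ p)
    ... | inj₂ y⊆x = inj₂ λ p → subst T (sym (s≗ p)) ∘ y⊆x p ∘ subst T (t≗ p)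

    -- Contrapositive form of an inclusion: the members of the k-th chain avoiding x are among those
    -- avoiding y.
    _⊑[_]_ : Carrier → Fin m → Carrier → Set _
    x ⊑[ k ] y = ∀ s → s ∈ miΔ[ k ] → T (s y) → T (s x)

    ⋢⇒separated : ∀ {k x y} → ¬ x ⊑[ k ] y → ∃[ s ] (s ∈ miΔ[ k ] × T (s y) × ¬ T (s x))
    ⋢⇒separated x⋢y =
      let s , s-sep = ¬∀⇒∃¬ x⋢y
          s∈ , s-sep′ = ¬→⇒× s-sep
      in s , s∈ , ¬→⇒× s-sep′

    -- If s contains y but not x, a member t containing x is not contained in s; so it contains s,
    -- and with it y.
    ⊑-total : ∀ k x y → x ⊑[ k ] y ⊎ y ⊑[ k ] x
    ⊑-total k x y with em _ {x ⊑[ k ] y}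
    ... | yes x⊑y = inj₁ x⊑y
    ... | no x⋢y with s , s∈ , y∈s , x∉s ← ⋢⇒separated x⋢y =
      inj₂ λ t t∈ x∈t → [ (λ t⊆s → ⊥-elim (x∉s (t⊆s x x∈t))) , (λ s⊆t → s⊆t y y∈s) ]′
        (miΔ[]-total k t∈ s∈)

    ≤⇒⊑ : ∀ k {x y} → x ≤ y → x ⊑[ k ] y
    ≤⇒⊑ k x≤y s ((s-ideal , _) , _) = IsIdeal.initialSegment s-ideal _ _ x≤y

    ∨-least-⊑ : ∀ k {x y z} → x ⊑[ k ] z → y ⊑[ k ] z → (x ∨ y) ⊑[ k ] z
    ∨-least-⊑ k x⊑z y⊑z s s∈@((s-ideal , _) , _) z∈s =
      ∨-∈ s-ideal (x⊑z s s∈ z∈s) (y⊑z s s∈ z∈s)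

    ⊑⇒≤ : ∀ {x y} → (∀ k → x ⊑[ k ] y) → x ≤ y
    ⊑⇒≤ x⊑y = by-contradiction λ x≰y →
      let s , s-mi , y∈s , x∉s = miΔ-separates x≰y
          k , z , s≗ = miΔ⇒lower s-mi
      in x∉s (x⊑y k s (s-mi , z , s≗) y∈s)

    -- ⊑[ k ] lies in too large a universe for TotalOrder c ℓ₁ ℓ₂.
    Small : ∀ ℓ → Fin m → Carrier → Carrier → Set ℓ
    Small ℓ k x y = Lift ℓ (T (⌊ x ⊑[ k ]_ ⌋ y))

    small⁺ : ∀ {ℓ k x y} → x ⊑[ k ] y → Small ℓ k x y
    small⁺ {k = k} {x} x⊑y = lift (⌊⌋⁺ (x ⊑[ k ]_) x⊑y)

    small⁻ : ∀ {ℓ k x y} → Small ℓ k x y → x ⊑[ k ] y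
    small⁻ {k = k} {x} x⊑y = ⌊⌋⁻ (x ⊑[ k ]_) (Lift.lower x⊑y)

    -- A quotient of P: the carrier is kept and `_≈_` identifies points, so each coordinate of
    -- `miΔ-embedding` is the identity.
    miΔ-chain : Fin m → TotalOrder c ℓ₁ ℓ₂
    miΔ-chain k = record
      { Carrier = Carrier
      ; _≈_ = λ x y → Small ℓ₁ k x y × Small ℓ₁ k y x
      ; _≤_ = Small ℓ₂ k
      ; isTotalOrder = record
        { isPartialOrder = record
          { isPreorder = record
            { isEquivalence = record
              { refl  = small⁺ ⊑-refl , small⁺ ⊑-refl
              ; sym   = λ (x⊑y , y⊑x) → y⊑x , x⊑y
              ; trans = λ (x⊑y , y⊑x) (y⊑z , z⊑y) →
                  small⁺ (⊑-trans (small⁻ x⊑y) (small⁻ y⊑z)) ,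
                  small⁺ (⊑-trans (small⁻ z⊑y) (small⁻ y⊑x))
              }
            ; reflexive = λ (x⊑y , _) → small⁺ (small⁻ x⊑y)
            ; trans     = λ x⊑y y⊑z → small⁺ (⊑-trans (small⁻ x⊑y) (small⁻ y⊑z))
            }
          ; antisym = λ x⊑y y⊑x → small⁺ (small⁻ x⊑y) , small⁺ (small⁻ y⊑x)
          }
        ; total = λ x y → [ inj₁ ∘ small⁺ , inj₂ ∘ small⁺ ]′ (⊑-total k x y)
        }
      }
      where
      ⊑-refl : ∀ {x} → x ⊑[ k ] x
      ⊑-refl _ _ = id
      ⊑-trans : ∀ {x y z} → x ⊑[ k ] y → y ⊑[ k ] z → x ⊑[ k ] z
      ⊑-trans x⊑y y⊑z s s∈ = x⊑y s s∈ ∘ y⊑z s s∈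

    miΔ-embedding : JoinEmbedding P miΔ-chain
    miΔ-embedding = (λ x _ → x) , record
      { isMagmaHomomorphism = record
        { isRelHomomorphism = record
          { cong = λ x≈y k → small⁺ (≤⇒⊑ k (P.reflexive x≈y)) ,
                             small⁺ (≤⇒⊑ k (P.reflexive (P.Eq.sym x≈y)))
          }
        ; homo = λ x y k →
            small⁺ (∨-least-⊑ k (small⁻ {ℓ₂} (Max.x≤x⊔y (miΔ-chain k) x y))
                                (small⁻ {ℓ₂} (Max.x≤y⊔x (miΔ-chain k) x y))) ,
            small⁺ (small⁻ {ℓ₂} (Max.⊔-lub (miΔ-chain k) {x ∨ y} {x} {y}
              (small⁺ (≤⇒⊑ k (x≤x∨y x y))) (small⁺ (≤⇒⊑ k (y≤x∨y x y)))))
        }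
      ; injective = λ x≈y → P.antisym (⊑⇒≤ λ k → small⁻ (proj₁ (x≈y k)))
                                      (⊑⇒≤ λ k → small⁻ (proj₂ (x≈y k)))
      }

    -- Each pair of rationals q < r yields an ideal separating their images; the
    -- ideals of disjoint pairs are comparable in the order of the pairs.
    miΔ-chain-scattered : OrderScattered (miΔ (Id P)) →
                          ∀ k → OrderScattered (TotalOrder.poset (miΔ-chain k))
    miΔ-chain-scattered sc k (g , g-mono) =
      DenseOrder.dense⇒¬scattered {_≺_ = _≺_}
        (λ {x} {y} {z} → ≺-trans {x} {y} {z}) (λ {x} {z} → ≺-dense {x} {z})
        {x = _ , _ , below -2ℚ} {z = _ , _ , below ℚ.0ℚ} (below -1ℚ)
        (miΔ (Id P)) ideal (λ {x} {y} → ideal-mono {x} {y}) sc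
      where
      open IsOrderMonomorphism g-mono using (mono; cancel)
      _≺_ : Rel (∃[ q ] ∃[ r ] q ℚ.< r) 0ℓ
      (_ , r , _) ≺ (q , _ , _) = r ℚ.< q

      ≺-trans : ∀ {x y z} → x ≺ y → y ≺ z → x ≺ z
      ≺-trans {y = _ , _ , s<t} r<s t<u = ℚ.<-trans r<s (ℚ.<-trans s<t t<u)

      ≺-dense : ∀ {x z} → x ≺ z → ∃[ y ] (x ≺ y × y ≺ z)
      ≺-dense r<q =
        let s , r<s , s<q = ℚ.<-dense r<q
            t , s<t , t<q = ℚ.<-dense s<q
        in (s , t , s<t) , r<s , t<q

      below : ∀ q → proj₁ (ℚ-unbounded-below q) ℚ.< q
      below = proj₂ ∘ ℚ-unbounded-below

      -1ℚ -2ℚ : ℚ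
      -1ℚ = proj₁ (ℚ-unbounded-below ℚ.0ℚ)
      -2ℚ = proj₁ (ℚ-unbounded-below -1ℚ)

      separate : ∀ {q r} → q ℚ.< r → ∃[ s ] (s ∈ miΔ[ k ] × T (s (g q)) × ¬ T (s (g r)))
      separate q<r = ⋢⇒separated λ gr⊑gq →
        ℚ.<-irrefl refl (ℚ.≤-<-trans (cancel (small⁺ gr⊑gq)) q<r)

      ideal : ∃[ q ] ∃[ r ] q ℚ.< r → Poset.Carrier (miΔ (Id P))
      ideal (_ , _ , q<r) = let s , ((s-ideal , s-cmi) , _) , _ = separate q<r in (s , s-ideal) , s-cmi

      ideal-mono : ∀ {x y} → x ≺ y → Poset._≤_ (miΔ (Id P)) (ideal x) (ideal y) ×
                                     ¬ Poset._≤_ (miΔ (Id P)) (ideal y) (ideal x)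
      ideal-mono {_ , _ , q<r} {q′ , _ , q′<r′} r<q′ =
        let s , s∈ , _ , gr∉s = separate q<r
            t , t∈ , gq′∈t , _ = separate q′<r′
            t⊈s = λ t⊆s → gr∉s (small⁻ (mono (ℚ.<⇒≤ r<q′)) s s∈ (t⊆s (g q′) gq′∈t))
        in [ id , (λ t⊆s → ⊥-elim (t⊈s t⊆s)) ]′ (miΔ[]-total k s∈ t∈) , t⊈s

    embeds-in-scattered-chains : OrderScattered (miΔ (Id P)) → EmbedsInScatteredChains P (Fin m)
    embeds-in-scattered-chains sc = miΔ-chain , miΔ-chain-scattered sc , miΔ-embedding

theorem9p4 : (∀ ℓ → ExcludedMiddle ℓ) →
    (∀ a b → Extensionality a b) →
    ∀ {c ℓ₁ ℓ₂} (P : JoinSemilattice c ℓ₁ ℓ₂) (n : ℕ) →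
    IsJoinDimension P (Fin n) →
    (EmbedsInScatteredChains P (Fin n) ⇔ (∃[ m ] EmbedsInScatteredChains P (Fin m))) ×
    ((∃[ m ] EmbedsInScatteredChains P (Fin m)) ⇔ TopologicallyScattered (IsIdeal P)) ×
    (TopologicallyScattered (IsIdeal P) ⇔ OrderScattered (Id P)) ×
    (OrderScattered (Id P) ⇔ OrderScattered (miΔ (Id P))) ×
    (OrderScattered (miΔ (Id P)) ⇔ TopologicallyScattered (ClosureIn (IsIdeal P) (miΔIdeals P)))
theorem9p4 em _ P n ((C , C-emb) , _) =
  -- Everything follows from (i) ⇒ (ii) ⇒ (iii) ⇒ (iv) ⇒ (v) ⇒ (i) together with (iii) ⇒ (vi) ⇒ (v).
  mk⇔ (n ,_) (v⇒i ∘ miΔ-scattered ∘ Id-scattered ∘ ii⇒iii) ,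
  mk⇔ ii⇒iii (iv⇒ii ∘ Id-scattered) ,
  mk⇔ Id-scattered (ii⇒iii ∘ iv⇒ii) ,
  mk⇔ miΔ-scattered (Id-scattered ∘ v⇒iii) ,
  mk⇔ (Classical.scattered-⊆ em proj₁ ∘ v⇒iii) miΔ-scattered-of-closure
  where
  open Ideals em P
  ii⇒iii : ∃[ m ] EmbedsInScatteredChains P (Fin m) → TopologicallyScattered (IsIdeal P)
  ii⇒iii (_ , D , D-scattered , D-emb) = Embedding.ideals-scattered D D-emb D-scattered
  v⇒i : OrderScattered (miΔ (Id P)) → EmbedsInScatteredChains P (Fin n)
  v⇒i = Embedding.embeds-in-scattered-chains C C-emb
  v⇒iii : OrderScattered (miΔ (Id P)) → TopologicallyScattered (IsIdeal P)
  v⇒iii sc = ii⇒iii (n , v⇒i sc)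
  iv⇒ii : OrderScattered (Id P) → ∃[ m ] EmbedsInScatteredChains P (Fin m)
  iv⇒ii sc = n , v⇒i (miΔ-scattered sc)
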